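{- Let $G$ be a bridgeless cubic graph, let $J_1,J_2,J_3$ be joins of $G$, and let $k=|E_0|+\frac{3}{2}\sum_{i=1}^3 n(J_i)$, where $E_0$ is the set of edges of $G$ contained in none of $J_1,J_2,J_3$ and $n(J_i)$ is the number of $J_i$-vertices. Then $$\sum_{i=1}^3 |\overline{J_i}|_{odd}\le 2k.$$
   Context: A join of a graph $H$ is a set $J\subseteq E(H)$ such that every vertex has degrees of the same parity in $H$ and in the spanning subgraph with edge set $J$; in a cubic graph every vertex has degree $1$ or $3$ in $J$, and a vertex of degree $3$ in $J$ is a $J$-vertex. For a join $J$ of $G$, $\overline{J}$ denotes the complement of $J$, i.e. the spanning subgraph $(V(G),E(G)\setminus J)$, and $|H|_{odd}$ denotes the number of components of a graph $H$ with an odd number of vertices. (In the paper's terminology, the subgraph $G[E_0\cup E_2\cup E_3]$, where $E_i$ is the set of edges in exactly $i$ of the joins, is the weak $k$-core of $G$ with respect to $J_1,J_2,J_3$.) -}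

module Defs where

open import Data.Nat using (ℕ; zero; suc; _+_; _*_; _%_; _≡ᵇ_; _<ᵇ_)
open import Data.Bool using (Bool; true; false; _∧_; _∨_; not; if_then_else_)
open import Data.Fin using (Fin; toℕ; _≟_)
open import Data.Product using (_×_; proj₁; proj₂)
open import Data.List using (List; map; allFin)
open import Data.Nat.ListAction using (sum)
open import Data.Bool.ListAction using (any)
open import Relation.Nullary.Decidable using (isYes)
open import Relation.Binary.PropositionalEquality using (_≡_; _≢_)

-- A finite loopless multigraph: vertices Fin n, edges Fin m,
-- each edge has two distinct endpoints (parallel edges allowed).
record Graph : Set where
  field
    n : ℕ
    m : ℕ
    ends : Fin m → Fin n × Fin n
    loopless : ∀ e → proj₁ (ends e) ≢ proj₂ (ends e)
open Graph public

-- A set of edges (spanning subgraph) as a Boolean predicate on edges.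
EdgeSet : Graph → Set
EdgeSet G = Fin (m G) → Bool

VertexSet : Graph → Set
VertexSet G = Fin (n G) → Bool

count : ∀ {k} → (Fin k → Bool) → ℕ
count {k} f = sum (map (λ i → if f i then 1 else 0) (allFin k))

anyFin : ∀ {k} → (Fin k → Bool) → Bool
anyFin {k} f = any f (allFin k)

_==_ : ∀ {k} → Fin k → Fin k → Bool
a == b = isYes (a ≟ b)

allEdges : (G : Graph) → EdgeSet G
allEdges G _ = true

complement : (G : Graph) → EdgeSet G → EdgeSet G
complement G J e = not (J e)

incident : (G : Graph) → Fin (m G) → Fin (n G) → Bool
incident G e v = (proj₁ (ends G e) == v) ∨ (proj₂ (ends G e) == v)

deg : (G : Graph) → EdgeSet G → Fin (n G) → ℕ
deg G S v = count (λ e → S e ∧ incident G e v)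

Cubic : Graph → Set
Cubic G = ∀ v → deg G (allEdges G) v ≡ 3

IsJoin : (G : Graph) → EdgeSet G → Set
IsJoin G J = ∀ v → deg G J v % 2 ≡ deg G (allEdges G) v % 2

nJ : (G : Graph) → EdgeSet G → ℕ
nJ G J = count (λ v → deg G J v ≡ᵇ 3)

step : (G : Graph) → EdgeSet G → VertexSet G → VertexSet G
step G S R w = R w ∨ anyFin (λ e → S e ∧
  ((R (proj₁ (ends G e)) ∧ (proj₂ (ends G e) == w)) ∨
   (R (proj₂ (ends G e)) ∧ (proj₁ (ends G e) == w))))

iter : ∀ {A : Set} → ℕ → (A → A) → A → A
iter zero f x = x
iter (suc k) f x = f (iter k f x)

-- vertices reachable from u in the spanning subgraph S
-- (n iterations suffice since a path has at most n - 1 edges)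
reachSet : (G : Graph) → EdgeSet G → Fin (n G) → VertexSet G
reachSet G S u = iter (n G) (step G S) (λ w → u == w)

Reach : (G : Graph) → EdgeSet G → Fin (n G) → Fin (n G) → Set
Reach G S u v = reachSet G S u v ≡ true

Bridgeless : Graph → Set
Bridgeless G = ∀ e → Reach G (λ f → not (f == e)) (proj₁ (ends G e)) (proj₂ (ends G e))

isOdd : ℕ → Bool
isOdd k = k % 2 ≡ᵇ 1

isRep : (G : Graph) → EdgeSet G → Fin (n G) → Bool
isRep G S v = not (anyFin (λ w → (toℕ w <ᵇ toℕ v) ∧ reachSet G S v w))

oddComponents : (G : Graph) → EdgeSet G → ℕ
oddComponents G S = count (λ v → isRep G S v ∧ isOdd (count (reachSet G S v)))

E0 : (G : Graph) → EdgeSet G → EdgeSet G → EdgeSet G → ℕ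
E0 G J₁ J₂ J₃ = count (λ e → not (J₁ e ∨ J₂ e ∨ J₃ e))

{-# OPTIONS --safe #-}
module Submission where

-- Discharging over vertices, with all quantities doubled. Call a vertex special if it is a
-- Jᵢ-vertex for some i; otherwise every join has exactly one edge there. A vertex v pays to
-- its component C in the complement of Jᵢ
--   2, if v is special;
--   otherwise, the number (0 or 1) of Jᵢ-edges at v that lie in a second join, plus
--   1 if v meets an edge of E₃ and each neighbour of v along an E₀-edge pays nothing
--   (before this bonus) to its own component in the complement of Jᵢ.
-- Every odd C without special vertices meets Jᵢ ∩ Jⱼ an odd number of times (counted at the
-- vertices of C) for both j ≠ i: the edges of Jⱼ ∖ Jᵢ stay inside C or outside it. So C
-- receives at least 2 without bonus, unless its only income comes from one E₃-edge, at a
-- vertex which then qualifies for the bonus. Conversely a non-special v pays at most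
-- 2 · #(E₀-edges at v), since it grants the bonus for at most one i, and a special v pays
-- at most 6; summing over all vertices gives 4|E₀| + 6 Σ n(Jᵢ).

open import Defs
import Algebra.Properties.Semiring.Sum
open import Data.Bool using (Bool; true; false; _∧_; _∨_; not; if_then_else_)
open import Data.Bool.Properties using (∧-conicalˡ; ∧-conicalʳ; ∨-conicalˡ; ∨-conicalʳ; T-≡; ∧-assoc; ∧-comm)
import Data.Bool as Bool
open import Data.Empty using (⊥; ⊥-elim)
open import Data.Fin using (Fin; zero; suc; toℕ; _≟_)
open import Data.Fin.Properties using (all?; toℕ-injective; suc-injective)
open import Data.List using (List; []; _∷_; tabulate; map; allFin)
import Data.List.Properties as List
open import Data.List.Relation.Unary.Any.Properties using (any⁺; any⁻; tabulate⁺; tabulate⁻)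
import Data.Nat.ListAction as List
open import Data.Nat using (ℕ; zero; suc; _+_; _*_; _%_; _≤_; _<_; z≤n; s≤s; _≡ᵇ_; _≤?_)
open import Data.Nat.DivMod using (m*n%n≡0)
open import Data.Nat.Properties hiding (_≟_; suc-injective)
import Data.Nat.Properties as ℕ
open import Data.Nat.Tactic.RingSolver using (solve-∀)
open import Data.Product using (_×_; _,_; proj₁; proj₂; ∃)
open import Data.Sum using (_⊎_; inj₁; inj₂)
open import Function using (_∘_; id; Equivalence)
open import Relation.Binary.Definitions using (tri<; tri≈; tri>)
open import Relation.Binary.PropositionalEquality
open import Relation.Nullary using (¬_; Dec; yes; no; contradiction)
open import Relation.Nullary.Decidable using (isYes; _×-dec_; _→-dec_)
open Algebra.Properties.Semiring.Sum +-*-semiring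
  using (sum; sum-cong-≗; sum-replicate-zero; ∑-distrib-+; ∑-comm; *-distribˡ-sum; *-distribʳ-sum)

⟦_⟧ : Bool → ℕ
⟦ b ⟧ = if b then 1 else 0

-- Sums over Fin

sum-mono : ∀ {k} {f g : Fin k → ℕ} → (∀ i → f i ≤ g i) → sum f ≤ sum g
sum-mono {zero}  f≤g = z≤n
sum-mono {suc k} f≤g = +-mono-≤ (f≤g zero) (sum-mono (f≤g ∘ suc))

-- Applied to indicators of nested sets: a growing set is either unchanged or gains an element. This
-- bounds the number of effective reachability steps.
sum-mono-⊎ : ∀ {k} {f g : Fin k → ℕ} → (∀ i → f i ≤ g i) → (∀ i → f i ≡ g i) ⊎ sum f < sum g
sum-mono-⊎ {zero} f≤g = inj₁ λ ()
sum-mono-⊎ {suc k} f≤g with m≤n⇒m<n∨m≡n (f≤g zero) | sum-mono-⊎ (f≤g ∘ suc)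
... | inj₁ lt | _       = inj₂ (+-mono-<-≤ lt (sum-mono (f≤g ∘ suc)))
... | inj₂ _  | inj₂ lt = inj₂ (+-mono-≤-< (f≤g zero) lt)
... | inj₂ eq | inj₁ h  = inj₁ λ { zero → eq ; (suc i) → h i }

term≤sum : ∀ {k} (f : Fin k → ℕ) i → f i ≤ sum f
term≤sum f zero    = m≤m+n _ _
term≤sum f (suc i) = ≤-trans (term≤sum (f ∘ suc) i) (m≤n+m _ _)

two-terms≤sum : ∀ {k} (f : Fin k → ℕ) {i j} → i ≢ j → f i + f j ≤ sum f
two-terms≤sum f {zero}  {zero}  i≢j = contradiction refl i≢j
two-terms≤sum f {zero}  {suc j} i≢j = +-monoʳ-≤ (f zero) (term≤sum (f ∘ suc) j)
two-terms≤sum f {suc i} {zero}  i≢j =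
  subst (_≤ sum f) (+-comm (f zero) (f (suc i))) (+-monoʳ-≤ (f zero) (term≤sum (f ∘ suc) i))
two-terms≤sum f {suc i} {suc j} i≢j =
  ≤-trans (two-terms≤sum (f ∘ suc) (i≢j ∘ cong suc)) (m≤n+m _ _)

sum-pos : ∀ {k} (f : Fin k → ℕ) → 0 < sum f → ∃ λ i → 0 < f i
sum-pos {suc k} f p with f zero in eq
... | suc _ = zero , subst (0 <_) (sym eq) (s≤s z≤n)
... | zero with sum-pos (f ∘ suc) p
...   | i , q = suc i , q

sum-⟦⟧≤ : ∀ {k} (f : Fin k → Bool) → sum (⟦_⟧ ∘ f) ≤ k
sum-⟦⟧≤ {zero}  f = z≤n
sum-⟦⟧≤ {suc k} f with f zero
... | true  = s≤s (sum-⟦⟧≤ (f ∘ suc))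
... | false = m≤n⇒m≤1+n (sum-⟦⟧≤ (f ∘ suc))

sum-unique≤1 : ∀ {k} (f : Fin k → Bool) → (∀ i j → f i ≡ true → f j ≡ true → i ≡ j) → sum (⟦_⟧ ∘ f) ≤ 1
sum-unique≤1 {zero}  f uniq = z≤n
sum-unique≤1 {suc k} f uniq with f zero in f0
... | false = sum-unique≤1 (f ∘ suc) (λ i j p q → suc-injective (uniq (suc i) (suc j) p q))
... | true  = s≤s (≤-reflexive (trans (sum-cong-≗ rest) (sum-replicate-zero k)))
  where
  rest : ∀ i → ⟦ f (suc i) ⟧ ≡ 0
  rest i with f (suc i) in fi
  ... | false = refl
  ... | true  with () ← uniq zero (suc i) f0 fi

==-refl : ∀ {k} (a : Fin k) → (a == a) ≡ true
==-refl a with a ≟ a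
... | yes _ = refl
... | no a≢a = contradiction refl a≢a

==⇒≡ : ∀ {k} {a b : Fin k} → (a == b) ≡ true → a ≡ b
==⇒≡ {a = a} {b} p with a ≟ b
... | yes eq = eq

==-suc : ∀ {k} (a b : Fin k) → (suc a == suc b) ≡ (a == b)
==-suc a b with a ≟ b
... | yes _ = refl
... | no _  = refl

sum-select : ∀ {k} (a : Fin k) (g : Fin k → ℕ) → sum (λ v → ⟦ a == v ⟧ * g v) ≡ g a
sum-select {suc k} zero g = begin
  1 * g zero + sum {k} (λ _ → 0)  ≡⟨ cong₂ _+_ (*-identityˡ (g zero)) (sum-replicate-zero k) ⟩
  g zero + 0                      ≡⟨ +-identityʳ (g zero) ⟩
  g zero                          ∎
  where open ≡-Reasoning
sum-select {suc k} (suc a) g = trans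
  (sum-cong-≗ (λ v → cong (λ b → ⟦ b ⟧ * g (suc v)) (==-suc a v)))
  (sum-select a (g ∘ suc))

count≡sum : ∀ {k} (f : Fin k → Bool) → count f ≡ sum (⟦_⟧ ∘ f)
count≡sum {k} f = trans (cong List.sum (List.map-tabulate {n = k} id (⟦_⟧ ∘ f))) (sum-tabulate (⟦_⟧ ∘ f))
  where
  sum-tabulate : ∀ {k} (g : Fin k → ℕ) → List.sum (tabulate g) ≡ sum g
  sum-tabulate {zero}  g = refl
  sum-tabulate {suc k} g = cong (g zero +_) (sum-tabulate (g ∘ suc))

-- Boolean disjunction and search over `Fin`

∨-split : ∀ {a b} → a ∨ b ≡ true → a ≡ true ⊎ b ≡ true
∨-split {true}  p = inj₁ p
∨-split {false} p = inj₂ p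

∨-introˡ : ∀ {a} b → a ≡ true → a ∨ b ≡ true
∨-introˡ b refl = refl

∨-introʳ : ∀ {b} a → b ≡ true → a ∨ b ≡ true
∨-introʳ true  _ = refl
∨-introʳ false p = p

anyFin⁺ : ∀ {k} (f : Fin k → Bool) i → f i ≡ true → anyFin f ≡ true
anyFin⁺ f i p = Equivalence.to T-≡ (any⁺ f (tabulate⁺ i (Equivalence.from T-≡ p)))

anyFin⁻ : ∀ {k} (f : Fin k → Bool) → anyFin f ≡ true → ∃ λ i → f i ≡ true
anyFin⁻ {k} f p with tabulate⁻ (any⁻ f (allFin k) (Equivalence.from T-≡ p))
... | i , q = i , Equivalence.to T-≡ q

-- Reachability

module Components (G : Graph) (S : EdgeSet G) where

  private
    src tgt : Fin (m G) → Fin (n G)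
    src e = proj₁ (ends G e)
    tgt e = proj₂ (ends G e)

  _⊆_ : VertexSet G → VertexSet G → Set
  R ⊆ K = ∀ w → R w ≡ true → K w ≡ true

  -- Membership of the two ends is compared by an equality of Booleans, so the complement of a
  -- closed set is closed too.
  Closed : VertexSet G → Set
  Closed R = ∀ e → S e ≡ true → R (src e) ≡ R (tgt e)

  -- A vertex gained in the step is joined by an `S`-edge to a vertex of `R`, hence of `K`;
  -- closedness of `K` carries membership across that edge.
  step-closed : ∀ {R K} → R ⊆ K → Closed K → step G S R ⊆ K
  step-closed {R} {K} R⊆K K-closed w p with ∨-split {R w} p
  ... | inj₁ q = R⊆K w q
  ... | inj₂ q with anyFin⁻ _ q
  ...   | e , r with ∨-split {R (src e) ∧ (tgt e == w)} (∧-conicalʳ (S e) _ r)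
  ...     | inj₁ t = subst (λ x → K x ≡ true) (==⇒≡ (∧-conicalʳ (R (src e)) _ t))
                       (trans (sym (K-closed e (∧-conicalˡ (S e) _ r))) (R⊆K _ (∧-conicalˡ (R (src e)) _ t)))
  ...     | inj₂ t = subst (λ x → K x ≡ true) (==⇒≡ (∧-conicalʳ (R (tgt e)) _ t))
                       (trans (K-closed e (∧-conicalˡ (S e) _ r)) (R⊆K _ (∧-conicalˡ (R (tgt e)) _ t)))

  -- If an `S`-edge had only one end in `R`, the step would add the other.
  fixed⇒closed : ∀ {R} → step G S R ⊆ R → Closed R
  fixed⇒closed {R} fixed e s with R (src e) in p | R (tgt e) in q
  ... | true  | true  = refl
  ... | false | false = refl
  ... | true  | false = trans (sym (fixed (tgt e) (∨-introʳ (R (tgt e)) (anyFin⁺ _ e lemma)))) q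
    where
    lemma : S e ∧ ((R (src e) ∧ (tgt e == tgt e)) ∨ (R (tgt e) ∧ (src e == tgt e))) ≡ true
    lemma rewrite s | p | ==-refl (tgt e) = refl
  ... | false | true  = trans (sym p) (fixed (src e) (∨-introʳ (R (src e)) (anyFin⁺ _ e lemma)))
    where
    lemma : S e ∧ ((R (src e) ∧ (tgt e == src e)) ∨ (R (tgt e) ∧ (src e == src e))) ≡ true
    lemma rewrite s | p | q | ==-refl (src e) = refl

  -- `R` and `step G S R` agree only pointwise, so closedness of the next iterate gets its own
  -- proof: stepping twice stays inside `R`.
  fixed⇒step-closed : ∀ {R} → step G S R ⊆ R → Closed (step G S R)
  fixed⇒step-closed {R} fixed = fixed⇒closed λ w p →
    ∨-introˡ _ (step-closed {step G S R} {R} fixed (fixed⇒closed fixed) w p)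

  iter-closed : ∀ k {R K} → R ⊆ K → Closed K → iter k (step G S) R ⊆ K
  iter-closed zero    R⊆K K-closed = R⊆K
  iter-closed (suc k) R⊆K K-closed = step-closed (iter-closed k R⊆K K-closed) K-closed

  ⊆-iter : ∀ k {R} → R ⊆ iter k (step G S) R
  ⊆-iter zero    w p = p
  ⊆-iter (suc k) {R} w p = ∨-introˡ _ (⊆-iter k {R} w p)

  -- Each step either adds a vertex or has already saturated.
  saturate : ∀ u k → let R = iter k (step G S) (u ==_) in Closed R ⊎ k < sum (⟦_⟧ ∘ R)
  saturate u zero = inj₂ (≤-trans (≤-reflexive (sym (cong ⟦_⟧ (==-refl u)))) (term≤sum (λ w → ⟦ u == w ⟧) u))
  saturate u (suc k) with iter k (step G S) (u ==_) | saturate u k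
  ... | R | inj₁ c = inj₁ (fixed⇒step-closed {R} (step-closed {R} {R} (λ _ q → q) c))
  ... | R | inj₂ lt with sum-mono-⊎ {f = ⟦_⟧ ∘ R} {⟦_⟧ ∘ step G S R} (λ w → ⟦⟧≤⟦∨⟧ (R w) _)
    where
    ⟦⟧≤⟦∨⟧ : ∀ a b → ⟦ a ⟧ ≤ ⟦ a ∨ b ⟧
    ⟦⟧≤⟦∨⟧ true  b = ≤-refl
    ⟦⟧≤⟦∨⟧ false b = z≤n
  ...   | inj₂ more = inj₂ (≤-trans (s≤s lt) more)
  ...   | inj₁ same = inj₁ (fixed⇒step-closed {R} (λ w → ⟦⟧-injective (same w)))
    where
    ⟦⟧-injective : ∀ {a b} → ⟦ a ⟧ ≡ ⟦ b ⟧ → b ≡ true → a ≡ true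
    ⟦⟧-injective {true} {true} _ _ = refl

  -- The second alternative of `saturate` would put more than `n G` vertices into `Fin (n G)`.
  reach-closed : ∀ u → Closed (reachSet G S u)
  reach-closed u with saturate u (n G)
  ... | inj₁ c  = c
  ... | inj₂ lt = contradiction (≤-trans lt (sum-⟦⟧≤ (reachSet G S u))) 1+n≰n

  reach-refl : ∀ u → Reach G S u u
  reach-refl u = ⊆-iter (n G) u (==-refl u)

  -- With `reach-refl` and `reach-closed` this makes the reachable set the least closed set
  -- containing `u`. Transitivity and symmetry then follow from a choice of `K`, with no paths
  -- involved.
  reach-least : ∀ {u K} → K u ≡ true → Closed K → reachSet G S u ⊆ K
  reach-least {K = K} Ku = iter-closed (n G) (λ w p → subst (λ x → K x ≡ true) (==⇒≡ p) Ku)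

  reach-trans : ∀ {u v w} → Reach G S u v → Reach G S v w → Reach G S u w
  reach-trans {u} {w = w} u↝v = reach-least u↝v (reach-closed u) w

  -- The complement of the set reachable from v is closed as well.
  reach-sym : ∀ {u v} → Reach G S u v → Reach G S v u
  reach-sym {u} {v} u↝v with reachSet G S v u in eq
  ... | true  = refl
  ... | false = contradiction
    (trans (sym (cong not (reach-refl v)))
      (reach-least {K = not ∘ reachSet G S v} (cong not eq) (λ e s → cong not (reach-closed v e s)) v u↝v))
    λ ()

  rep≤ : ∀ {u v} → isRep G S u ≡ true → Reach G S u v → ¬ (toℕ v < toℕ u)
  rep≤ {u} {v} rep u↝v v<u = contradiction
    (trans (sym (cong not (anyFin⁺ _ v (cong₂ _∧_ (Equivalence.to T-≡ (<⇒<ᵇ v<u)) u↝v)))) rep)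
    λ ()

  rep-unique : ∀ {u v w} → isRep G S u ≡ true → isRep G S v ≡ true →
               Reach G S u w → Reach G S v w → u ≡ v
  rep-unique {u} {v} ru rv uw vw with <-cmp (toℕ u) (toℕ v)
  ... | tri≈ _ eq _ = toℕ-injective eq
  ... | tri< lt _ _ = contradiction lt (rep≤ rv (reach-trans vw (reach-sym uw)))
  ... | tri> _ _ gt = contradiction gt (rep≤ ru (reach-trans uw (reach-sym vw)))

  -- The weight of `v` is credited to the component of `v`. Pairs of an odd representative and a
  -- vertex it reaches are summed in both orders; by `rep-unique` no vertex is credited twice.
  oddComponents≤ : ∀ c (w : Fin (n G) → ℕ) →
    (∀ u → isOdd (count (reachSet G S u)) ≡ true → c ≤ sum (λ v → ⟦ reachSet G S u v ⟧ * w v)) →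
    c * oddComponents G S ≤ sum w
  oddComponents≤ c w heavy = begin
    c * oddComponents G S                            ≡⟨ cong (c *_) (count≡sum odd) ⟩
    c * sum (⟦_⟧ ∘ odd)                              ≡⟨ *-distribˡ-sum c (⟦_⟧ ∘ odd) ⟩
    sum (λ u → c * ⟦ odd u ⟧)                        ≤⟨ sum-mono own ⟩
    sum (λ u → sum (λ v → ⟦ covers u v ⟧ * w v))     ≡⟨ ∑-comm (λ u v → ⟦ covers u v ⟧ * w v) ⟩
    sum (λ v → sum (λ u → ⟦ covers u v ⟧ * w v))     ≡⟨ sum-cong-≗ (λ v → sym (*-distribʳ-sum (w v) (λ u → ⟦ covers u v ⟧))) ⟩
    sum (λ v → sum (λ u → ⟦ covers u v ⟧) * w v)     ≤⟨ sum-mono (λ v → *-monoˡ-≤ (w v) (sum-unique≤1 (λ u → covers u v) (λ u u′ → unique u u′ v))) ⟩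
    sum (λ v → 1 * w v)                              ≡⟨ sum-cong-≗ (λ v → *-identityˡ (w v)) ⟩
    sum w                                            ∎
    where
    open ≤-Reasoning
    odd : Fin (n G) → Bool
    odd u = isRep G S u ∧ isOdd (count (reachSet G S u))
    covers : Fin (n G) → Fin (n G) → Bool
    covers u v = odd u ∧ reachSet G S u v
    unique : ∀ u u′ v → covers u v ≡ true → covers u′ v ≡ true → u ≡ u′
    unique u u′ v p q = rep-unique
      (∧-conicalˡ (isRep G S u) _ (∧-conicalˡ (odd u) _ p)) (∧-conicalˡ (isRep G S u′) _ (∧-conicalˡ (odd u′) _ q))
      (∧-conicalʳ (odd u) _ p) (∧-conicalʳ (odd u′) _ q)
    own : ∀ u → c * ⟦ odd u ⟧ ≤ sum (λ v → ⟦ covers u v ⟧ * w v)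
    own u with odd u in eq
    ... | true  = ≤-trans (≤-reflexive (*-identityʳ c)) (heavy u (∧-conicalʳ (isRep G S u) _ eq))
    ... | false = ≤-trans (≤-reflexive (*-zeroʳ c)) z≤n

-- Degrees

module _ (G : Graph) where

  private
    src tgt : Fin (m G) → Fin (n G)
    src e = proj₁ (ends G e)
    tgt e = proj₂ (ends G e)

  wdeg : (Fin (m G) → ℕ) → Fin (n G) → ℕ
  wdeg f v = sum (λ e → f e * ⟦ incident G e v ⟧)

  ⟦∧⟧ : ∀ a b → ⟦ a ∧ b ⟧ ≡ ⟦ a ⟧ * ⟦ b ⟧
  ⟦∧⟧ true  b = sym (*-identityˡ ⟦ b ⟧)
  ⟦∧⟧ false b = refl

  deg≡sum : ∀ S v → deg G S v ≡ sum (λ e → ⟦ S e ∧ incident G e v ⟧)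
  deg≡sum S v = count≡sum (λ e → S e ∧ incident G e v)

  deg≡wdeg : ∀ S v → deg G S v ≡ wdeg (⟦_⟧ ∘ S) v
  deg≡wdeg S v = trans (deg≡sum S v) (sum-cong-≗ (λ e → ⟦∧⟧ (S e) (incident G e v)))

  wdeg-mono : ∀ {f g} → (∀ e → f e ≤ g e) → ∀ v → wdeg f v ≤ wdeg g v
  wdeg-mono f≤g v = sum-mono (λ e → *-monoˡ-≤ ⟦ incident G e v ⟧ (f≤g e))

  wdeg-+ : ∀ f g v → wdeg (λ e → f e + g e) v ≡ wdeg f v + wdeg g v
  wdeg-+ f g v = trans
    (sum-cong-≗ (λ e → *-distribʳ-+ ⟦ incident G e v ⟧ (f e) (g e)))
    (∑-distrib-+ (λ e → f e * ⟦ incident G e v ⟧) (λ e → g e * ⟦ incident G e v ⟧))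

  degs : List (EdgeSet G) → Fin (n G) → ℕ
  degs Ss v = List.sum (map (λ S → deg G S v) Ss)

  -- A list of edge sets acts as a multiset of edges. Comparing sums of degrees thereby reduces to
  -- comparing multiplicities of a single edge, a finite Boolean table.
  multiplicity : List (EdgeSet G) → Fin (m G) → ℕ
  multiplicity Ss e = List.sum (map (λ S → ⟦ S e ⟧) Ss)

  degs≡wdeg : ∀ Ss v → degs Ss v ≡ wdeg (multiplicity Ss) v
  degs≡wdeg []       v = sym (sum-replicate-zero (m G))
  degs≡wdeg (S ∷ Ss) v = trans (cong₂ _+_ (deg≡wdeg S v) (degs≡wdeg Ss v)) (sym (wdeg-+ (⟦_⟧ ∘ S) (multiplicity Ss) v))

  degs-mono : ∀ As Bs → (∀ e → multiplicity As e ≤ multiplicity Bs e) → ∀ v → degs As v ≤ degs Bs v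
  degs-mono As Bs le v = subst₂ _≤_ (sym (degs≡wdeg As v)) (sym (degs≡wdeg Bs v)) (wdeg-mono le v)

  degs-cong : ∀ As Bs → (∀ e → multiplicity As e ≡ multiplicity Bs e) → ∀ v → degs As v ≡ degs Bs v
  degs-cong As Bs eq v = ≤-antisym
    (degs-mono As Bs (≤-reflexive ∘ eq) v) (degs-mono Bs As (≤-reflexive ∘ sym ∘ eq) v)

  deg-mono : ∀ {A B} → (∀ e → ⟦ A e ⟧ ≤ ⟦ B e ⟧) → ∀ v → deg G A v ≤ deg G B v
  deg-mono {A} {B} le v = subst₂ _≤_ (sym (deg≡wdeg A v)) (sym (deg≡wdeg B v)) (wdeg-mono le v)

  deg-pos : ∀ {S e v} → S e ≡ true → incident G e v ≡ true → 0 < deg G S v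
  deg-pos {S} {e} {v} s i = begin
    1                                      ≡⟨ cong₂ (λ a b → ⟦ a ∧ b ⟧) s i ⟨
    ⟦ S e ∧ incident G e v ⟧               ≤⟨ term≤sum (λ e → ⟦ S e ∧ incident G e v ⟧) e ⟩
    sum (λ e → ⟦ S e ∧ incident G e v ⟧)   ≡⟨ deg≡sum S v ⟨
    deg G S v                              ∎
    where open ≤-Reasoning

  deg-pos⁻ : ∀ {S v} → 0 < deg G S v → ∃ λ e → S e ≡ true × incident G e v ≡ true
  deg-pos⁻ {S} {v} p with sum-pos (λ e → ⟦ S e ∧ incident G e v ⟧) (subst (0 <_) (deg≡sum S v) p)
  ... | e , q = e , ∧-conicalˡ (S e) _ (pos q) , ∧-conicalʳ (S e) _ (pos q)
    where
    pos : ∀ {b} → 0 < ⟦ b ⟧ → b ≡ true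
    pos {true} _ = refl

  -- Looplessness excludes the case where both ends are `v`, in which the disjunction would count 1
  -- and the sum 2.
  incident-ends : ∀ e v → ⟦ incident G e v ⟧ ≡ ⟦ src e == v ⟧ + ⟦ tgt e == v ⟧
  incident-ends e v with src e == v in p | tgt e == v in q
  ... | true  | true  = contradiction (trans (==⇒≡ p) (sym (==⇒≡ q))) (loopless G e)
  ... | true  | false = refl
  ... | false | _     = refl

  -- Exchanging the sums, each edge of `S` collects `g` from its two ends. A constant `g` gives the
  -- degree sum, an indicator `g` counts edge ends inside a vertex set.
  handshake : ∀ S (g : Fin (n G) → ℕ) →
    sum (λ v → g v * deg G S v) ≡ sum (λ e → ⟦ S e ⟧ * (g (src e) + g (tgt e)))
  handshake S g = begin
    sum (λ v → g v * deg G S v)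
      ≡⟨ sum-cong-≗ (λ v → trans (cong (g v *_) (deg≡wdeg S v)) (*-distribˡ-sum (g v) (λ e → ⟦ S e ⟧ * ⟦ incident G e v ⟧))) ⟩
    sum (λ v → sum (λ e → g v * (⟦ S e ⟧ * ⟦ incident G e v ⟧)))
      ≡⟨ ∑-comm (λ v e → g v * (⟦ S e ⟧ * ⟦ incident G e v ⟧)) ⟩
    sum (λ e → sum (λ v → g v * (⟦ S e ⟧ * ⟦ incident G e v ⟧)))
      ≡⟨ sum-cong-≗ edge ⟩
    sum (λ e → ⟦ S e ⟧ * (g (src e) + g (tgt e)))  ∎
    where
    open ≡-Reasoning
    rearrange : ∀ x s a b → x * (s * (a + b)) ≡ s * (a * x + b * x)
    rearrange = solve-∀
    edge : ∀ e → sum (λ v → g v * (⟦ S e ⟧ * ⟦ incident G e v ⟧)) ≡ ⟦ S e ⟧ * (g (src e) + g (tgt e))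
    edge e = begin
      sum (λ v → g v * (⟦ S e ⟧ * ⟦ incident G e v ⟧))
        ≡⟨ sum-cong-≗ (λ v → trans (cong (λ x → g v * (⟦ S e ⟧ * x)) (incident-ends e v))
                                   (rearrange (g v) ⟦ S e ⟧ ⟦ src e == v ⟧ ⟦ tgt e == v ⟧)) ⟩
      sum (λ v → ⟦ S e ⟧ * (⟦ src e == v ⟧ * g v + ⟦ tgt e == v ⟧ * g v))
        ≡⟨ *-distribˡ-sum ⟦ S e ⟧ (λ v → ⟦ src e == v ⟧ * g v + ⟦ tgt e == v ⟧ * g v) ⟨
      ⟦ S e ⟧ * sum (λ v → ⟦ src e == v ⟧ * g v + ⟦ tgt e == v ⟧ * g v)
        ≡⟨ cong (⟦ S e ⟧ *_) (∑-distrib-+ (λ v → ⟦ src e == v ⟧ * g v) (λ v → ⟦ tgt e == v ⟧ * g v)) ⟩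
      ⟦ S e ⟧ * (sum (λ v → ⟦ src e == v ⟧ * g v) + sum (λ v → ⟦ tgt e == v ⟧ * g v))
        ≡⟨ cong (⟦ S e ⟧ *_) (cong₂ _+_ (sum-select (src e) g) (sum-select (tgt e) g)) ⟩
      ⟦ S e ⟧ * (g (src e) + g (tgt e))  ∎

  sum-deg : ∀ S → sum (deg G S) ≡ 2 * count S
  sum-deg S = begin
    sum (deg G S)                   ≡⟨ sum-cong-≗ (λ v → *-identityˡ (deg G S v)) ⟨
    sum (λ v → 1 * deg G S v)       ≡⟨ handshake S (λ _ → 1) ⟩
    sum (λ e → ⟦ S e ⟧ * 2)         ≡⟨ *-distribʳ-sum 2 (⟦_⟧ ∘ S) ⟨
    sum (⟦_⟧ ∘ S) * 2               ≡⟨ cong (_* 2) (count≡sum S) ⟨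
    count S * 2                     ≡⟨ *-comm (count S) 2 ⟩
    2 * count S                     ∎
    where open ≡-Reasoning

  -- An edge of A outside I has both or neither of its ends in R.
  odd-crossing : ∀ (I A : EdgeSet G) R → Components.Closed G (complement G I) R →
    (∀ v → R v ≡ true → deg G A v ≡ 1) → isOdd (count R) ≡ true →
    0 < sum (λ v → ⟦ R v ⟧ * deg G (λ e → I e ∧ A e) v)
  odd-crossing I A R closed one odd = n≢0⇒n>0 λ none → contradiction
    (trans (sym odd) (cong isOdd (even none)))
    (λ eq → contradiction (trans eq (cong (_≡ᵇ 1) (m*n%n≡0 half 2))) λ ())
    where
    open ≡-Reasoning
    in-I out-I : EdgeSet G
    in-I  e = I e ∧ A e
    out-I e = not (I e) ∧ A e
    half : ℕ
    -- An edge of `A` outside `I` has both ends or neither in `R`, so it has twice as many ends in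
    -- `R` as the indicator of its source says.
    half = sum (λ e → ⟦ out-I e ⟧ * ⟦ R (src e) ⟧)
    split : ∀ i a → ⟦ a ⟧ + 0 ≡ ⟦ i ∧ a ⟧ + (⟦ not i ∧ a ⟧ + 0)
    split true  a = refl
    split false a = refl
    -- A vertex of `R` is counted through its only `A`-edge, which lies in `I` or outside it.
    vertex : ∀ v → ⟦ R v ⟧ ≡ ⟦ R v ⟧ * deg G in-I v + ⟦ R v ⟧ * deg G out-I v
    vertex v with R v in r
    ... | false = refl
    ... | true  = begin
      1                                         ≡⟨ one v r ⟨
      deg G A v                                 ≡⟨ +-identityʳ _ ⟨
      deg G A v + 0                             ≡⟨ degs-cong (A ∷ []) (in-I ∷ out-I ∷ []) (λ e → split (I e) (A e)) v ⟩
      deg G in-I v + (deg G out-I v + 0)        ≡⟨ cong (deg G in-I v +_) (+-identityʳ _) ⟩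
      deg G in-I v + deg G out-I v              ≡⟨ cong₂ _+_ (*-identityˡ (deg G in-I v)) (*-identityˡ (deg G out-I v)) ⟨
      1 * deg G in-I v + 1 * deg G out-I v      ∎
    double : ∀ s r → s * (r + r) ≡ s * r * 2
    double = solve-∀
    edge : ∀ e → ⟦ out-I e ⟧ * (⟦ R (src e) ⟧ + ⟦ R (tgt e) ⟧) ≡ ⟦ out-I e ⟧ * ⟦ R (src e) ⟧ * 2
    edge e with not (I e) in i
    ... | false = refl
    ... | true rewrite sym (closed e i) = double ⟦ A e ⟧ ⟦ R (src e) ⟧
    even : sum (λ v → ⟦ R v ⟧ * deg G in-I v) ≡ 0 → count R ≡ half * 2
    even none = begin
      count R
        ≡⟨ count≡sum R ⟩
      sum (⟦_⟧ ∘ R)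
        ≡⟨ sum-cong-≗ vertex ⟩
      sum (λ v → ⟦ R v ⟧ * deg G in-I v + ⟦ R v ⟧ * deg G out-I v)
        ≡⟨ ∑-distrib-+ (λ v → ⟦ R v ⟧ * deg G in-I v) (λ v → ⟦ R v ⟧ * deg G out-I v) ⟩
      sum (λ v → ⟦ R v ⟧ * deg G in-I v) + sum (λ v → ⟦ R v ⟧ * deg G out-I v)
        ≡⟨ cong₂ _+_ none (handshake out-I (⟦_⟧ ∘ R)) ⟩
      sum (λ e → ⟦ out-I e ⟧ * (⟦ R (src e) ⟧ + ⟦ R (tgt e) ⟧))
        ≡⟨ sum-cong-≗ edge ⟩
      sum (λ e → ⟦ out-I e ⟧ * ⟦ R (src e) ⟧ * 2)
        ≡⟨ *-distribʳ-sum 2 (λ e → ⟦ out-I e ⟧ * ⟦ R (src e) ⟧) ⟨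
      half * 2  ∎

-- Discharging

module Discharge (G : Graph) (special : VertexSet G) (none all : EdgeSet G) where

  private
    src tgt : Fin (m G) → Fin (n G)
    src e = proj₁ (ends G e)
    tgt e = proj₂ (ends G e)

  -- The payment before the bonus. `S` will be the set of edges of one join that lie in a second
  -- join.
  base : EdgeSet G → Fin (n G) → ℕ
  base S v = if special v then 2 else deg G S v

  -- There are two clauses because an edge orders its ends and `v` may be either. A special
  -- neighbour has base 2, so it spoils quietness.
  Quiet : EdgeSet G → Fin (n G) → Set
  Quiet S v = ∀ e → none e ≡ true → (src e ≡ v → base S (tgt e) ≡ 0) × (tgt e ≡ v → base S (src e) ≡ 0)

  quiet? : ∀ S v → Dec (Quiet S v)
  quiet? S v = all? λ e → (none e Bool.≟ true) →-dec
    (((src e ≟ v) →-dec (base S (tgt e) ℕ.≟ 0)) ×-dec ((tgt e ≟ v) →-dec (base S (src e) ℕ.≟ 0)))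

  -- At a non-special vertex each join will have degree 1, so `deg G all v` is 0 or 1 and serves as
  -- the indicator of an E₃-edge.
  extra : EdgeSet G → Fin (n G) → ℕ
  extra S v = if isYes (quiet? S v) then deg G all v else 0

  weight : EdgeSet G → Fin (n G) → ℕ
  weight S v = if special v then 2 else deg G S v + extra S v

  base≤weight : ∀ S v → base S v ≤ weight S v
  base≤weight S v with special v
  ... | true  = ≤-refl
  ... | false = m≤m+n _ _

  base-zero : ∀ {S v} → base S v ≡ 0 → special v ≡ false × deg G S v ≡ 0
  base-zero {S} {v} p with special v
  ... | false = refl , p

  module _ {S S′ : EdgeSet G} (bound : ∀ y → special y ≡ false → deg G none y ≤ deg G S y + deg G S′ y) where

    -- Two zero payments make `y` non-special, and `bound` then leaves no `none`-edge at `y`,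
    -- contradicting `e`.
    base-exclusive : ∀ {e y} → none e ≡ true → incident G e y ≡ true → base S y ≡ 0 → base S′ y ≡ 0 → ⊥
    base-exclusive {e} {y} e∈none i z z′ with base-zero {S} {y} z | base-zero {S′} {y} z′
    ... | ord , d | _ , d′ = contradiction
      (≤-trans (deg-pos G {e = e} e∈none i) (≤-trans (bound y ord) (≤-reflexive (cong₂ _+_ d d′)))) λ ()

    -- The neighbour of `v` along a `none`-edge would pay zero for both sets. Hence `v` grants at
    -- most one of the two bonuses.
    quiet-exclusive : ∀ {v} → 0 < deg G none v → Quiet S v → Quiet S′ v → ⊥
    quiet-exclusive pos q q′ with deg-pos⁻ G pos
    ... | e , e∈none , inc with ∨-split inc
    ...   | inj₁ s = base-exclusive e∈none (∨-introʳ _ (==-refl (tgt e)))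
                       (proj₁ (q e e∈none) (==⇒≡ s)) (proj₁ (q′ e e∈none) (==⇒≡ s))
    ...   | inj₂ t = base-exclusive e∈none (∨-introˡ _ (==-refl (src e)))
                       (proj₂ (q e e∈none) (==⇒≡ t)) (proj₂ (q′ e e∈none) (==⇒≡ t))

  module _ (I A B : EdgeSet G)
           (all≡ : ∀ e → all e ≡ I e ∧ A e ∧ B e)
           (none⇒∉I : ∀ e → none e ≡ true → not (I e) ≡ true)
           (deg-A : ∀ v → special v ≡ false → deg G A v ≡ 1)
           (deg-B : ∀ v → special v ≡ false → deg G B v ≡ 1)
           (R : VertexSet G) (closed : Components.Closed G (complement G I) R)
           (odd : isOdd (count R) ≡ true) where

    private
      AI BI shared : EdgeSet G
      AI e = I e ∧ A e
      BI e = I e ∧ B e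
      shared e = I e ∧ (A e ∨ B e)

      total : (Fin (n G) → ℕ) → ℕ
      total f = sum (λ v → ⟦ R v ⟧ * f v)

      total-+ : ∀ f g → total (λ v → f v + g v) ≡ total f + total g
      total-+ f g = trans (sum-cong-≗ (λ v → *-distribˡ-+ ⟦ R v ⟧ (f v) (g v)))
                          (∑-distrib-+ (λ v → ⟦ R v ⟧ * f v) (λ v → ⟦ R v ⟧ * g v))

      total-cong : ∀ {f g} → (∀ v → R v ≡ true → f v ≡ g v) → total f ≡ total g
      total-cong {f} {g} f≗g = sum-cong-≗ pointwise
        where
        pointwise : ∀ v → ⟦ R v ⟧ * f v ≡ ⟦ R v ⟧ * g v
        pointwise v with R v in r
        ... | true  = cong (1 *_) (f≗g v r)
        ... | false = refl

      total-mono : ∀ {f g} → (∀ v → f v ≤ g v) → total f ≤ total g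
      total-mono f≤g = sum-mono (λ v → *-monoʳ-≤ ⟦ R v ⟧ (f≤g v))

      term≤total : ∀ f v → R v ≡ true → f v ≤ total f
      term≤total f v r = ≤-trans
        (≤-reflexive (trans (sym (*-identityˡ (f v))) (cong (λ b → ⟦ b ⟧ * f v) (sym r))))
        (term≤sum (λ v → ⟦ R v ⟧ * f v) v)

      two-terms≤total : ∀ f {u v} → u ≢ v → R u ≡ true → R v ≡ true → f u + f v ≤ total f
      two-terms≤total f {u} {v} u≢v ru rv = subst (_≤ total f)
        (cong₂ _+_ (trans (cong (λ b → ⟦ b ⟧ * f u) ru) (*-identityˡ (f u)))
                   (trans (cong (λ b → ⟦ b ⟧ * f v) rv) (*-identityˡ (f v))))
        (two-terms≤sum (λ v → ⟦ R v ⟧ * f v) u≢v)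

      total-pos : ∀ f → 0 < total f → ∃ λ v → R v ≡ true × 0 < f v
      total-pos f p with sum-pos (λ v → ⟦ R v ⟧ * f v) p
      ... | v , q with R v in r
      ...   | true = v , r , subst (0 <_) (*-identityˡ (f v)) q

      -- Inclusion-exclusion: an edge in all three sets is counted in both `AI` and `BI`.
      shared+all : ∀ v → deg G AI v + deg G BI v ≡ deg G shared v + deg G all v
      shared+all v = subst₂ (λ x y → deg G AI v + x ≡ deg G shared v + y) (+-identityʳ _) (+-identityʳ _)
        (degs-cong G (AI ∷ BI ∷ []) (shared ∷ all ∷ []) pointwise v)
        where
        pointwise : ∀ e → ⟦ AI e ⟧ + (⟦ BI e ⟧ + 0) ≡ ⟦ shared e ⟧ + (⟦ all e ⟧ + 0)
        pointwise e rewrite all≡ e with I e | A e | B e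
        ... | true  | true  | true  = refl
        ... | true  | true  | false = refl
        ... | true  | false | true  = refl
        ... | true  | false | false = refl
        ... | false | _     | _     = refl

      all≤shared : ∀ v → deg G all v ≤ deg G shared v
      all≤shared = deg-mono G pointwise
        where
        pointwise : ∀ e → ⟦ all e ⟧ ≤ ⟦ shared e ⟧
        pointwise e rewrite all≡ e with I e | A e | B e
        ... | true  | true  | true  = ≤-refl
        ... | true  | true  | false = z≤n
        ... | true  | false | _     = z≤n
        ... | false | _     | _     = z≤n

      -- By `odd-crossing`, `AI` and `BI` each contribute at least 1, and together they make up the
      -- base income plus the E₃-degrees. If the base income is at most 1, some `v` in `R` meets an
      -- E₃-edge. That edge alone is the base income, so `v` qualifies for the bonus.
      ordinary-case : (∀ v → R v ≡ true → special v ≡ false) → total (base shared) ≤ 1 →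
                      2 ≤ total (weight shared)
      ordinary-case ord base≤1 with total-pos (deg G all) all-pos
        where
        sum-crossings : 2 ≤ total (base shared) + total (deg G all)
        sum-crossings = begin
          1 + 1                                        ≤⟨ +-mono-≤ (odd-crossing G I A R closed (λ v r → deg-A v (ord v r)) odd)
                                                                   (odd-crossing G I B R closed (λ v r → deg-B v (ord v r)) odd) ⟩
          total (deg G AI) + total (deg G BI)          ≡⟨ total-+ (deg G AI) (deg G BI) ⟨
          total (λ v → deg G AI v + deg G BI v)        ≡⟨ total-cong (λ v r → trans (shared+all v) (cong (λ b → (if b then 2 else deg G shared v) + deg G all v)
                                                                                                     (sym (ord v r)))) ⟩
          total (λ v → base shared v + deg G all v)    ≡⟨ total-+ (base shared) (deg G all) ⟩
          total (base shared) + total (deg G all)      ∎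
          where open ≤-Reasoning
        all-pos : 0 < total (deg G all)
        all-pos = +-cancelˡ-≤ 1 1 _ (≤-trans sum-crossings (+-monoˡ-≤ (total (deg G all)) base≤1))
      ... | v , r , pos = begin
        -- The E₃-edge at `v` counts once in `shared` and once as bonus.
        2                                ≤⟨ +-mono-≤ (≤-trans pos (all≤shared v)) pos ⟩
        deg G shared v + deg G all v     ≡⟨ weight≡ ⟨
        weight shared v                  ≤⟨ term≤total (weight shared) v r ⟩
        total (weight shared)            ∎
        where
        open ≤-Reasoning
        base-pos : 1 ≤ base shared v
        base-pos rewrite ord v r = ≤-trans pos (all≤shared v)
        -- A second paying vertex in `R` would raise the base income to 2.
        silent : ∀ y → v ≢ y → R y ≡ true → base shared y ≡ 0
        silent y v≢y ry = n≤0⇒n≡0 (+-cancelˡ-≤ 1 _ 0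
          (≤-trans (+-monoˡ-≤ (base shared y) base-pos) (≤-trans (two-terms≤total (base shared) v≢y r ry) base≤1)))
        quiet : Quiet shared v
        -- A `none`-edge avoids `I`, so closedness keeps its other end in `R`; by looplessness that
        -- end differs from `v`, and `silent` applies.
        quiet e e∈none =
          (λ { refl → silent (tgt e) (loopless G e) (trans (sym (closed e (none⇒∉I e e∈none))) r) }) ,
          (λ { refl → silent (src e) (loopless G e ∘ sym) (trans (closed e (none⇒∉I e e∈none)) r) })
        weight≡ : weight shared v ≡ deg G shared v + deg G all v
        weight≡ rewrite ord v r with quiet? shared v
        ... | yes _ = refl
        ... | no ¬q = contradiction quiet ¬q

    -- Either a special vertex of `R` pays 2 alone, or the base income reaches 2, or the bonus fills
    -- the gap.
    odd-weight : 2 ≤ total (weight shared)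
    odd-weight with anyFin (λ v → R v ∧ special v) in eq
    ... | true with anyFin⁻ _ eq
    ...   | v , p = subst (_≤ total (weight shared))
                      (cong (if_then 2 else deg G shared v + extra shared v) (∧-conicalʳ (R v) _ p))
                      (term≤total (weight shared) v (∧-conicalˡ (R v) _ p))
    odd-weight | false with 2 ≤? total (base shared)
    ... | yes 2≤ = ≤-trans 2≤ (total-mono (base≤weight shared))
    ... | no 2≰  = ordinary-case ord (≤-pred (≰⇒> 2≰))
      where
      ord : ∀ v → R v ≡ true → special v ≡ false
      ord v r with special v in s
      ... | false = refl
      ... | true  = trans (sym (anyFin⁺ (λ v → R v ∧ special v) v (cong₂ _∧_ r s))) eq

-- Three joins of a cubic graph

-- The join property makes the degree odd and cubicity bounds it by 3.
join-deg : ∀ G J → Cubic G → IsJoin G J → ∀ v → (deg G J v ≡ᵇ 3) ≡ false → deg G J v ≡ 1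
join-deg G J cubic join v ≢3 = one-or-three (deg G J v) deg≤3
  (trans (join v) (cong (_% 2) (cubic v))) ≢3
  where
  deg≤3 : deg G J v ≤ 3
  deg≤3 = subst (deg G J v ≤_) (cubic v) (deg-mono G (λ e → ⟦⟧≤1 (J e)) v)
    where
    ⟦⟧≤1 : ∀ b → ⟦ b ⟧ ≤ 1
    ⟦⟧≤1 true  = ≤-refl
    ⟦⟧≤1 false = z≤n
  one-or-three : ∀ d → d ≤ 3 → d % 2 ≡ 1 → (d ≡ᵇ 3) ≡ false → d ≡ 1
  one-or-three 1 _ _ _ = refl
  one-or-three (suc (suc (suc (suc _)))) (s≤s (s≤s (s≤s ()))) _ _

module Joins (G : Graph) (cubic : Cubic G) (J₁ J₂ J₃ : EdgeSet G)
             (join₁ : IsJoin G J₁) (join₂ : IsJoin G J₂) (join₃ : IsJoin G J₃) where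

  none all shared₁ shared₂ shared₃ : EdgeSet G
  none e    = not (J₁ e ∨ J₂ e ∨ J₃ e)
  all e     = J₁ e ∧ J₂ e ∧ J₃ e
  shared₁ e = J₁ e ∧ (J₂ e ∨ J₃ e)
  shared₂ e = J₂ e ∧ (J₁ e ∨ J₃ e)
  shared₃ e = J₃ e ∧ (J₁ e ∨ J₂ e)

  special₁ special₂ special₃ special : VertexSet G
  special₁ v = deg G J₁ v ≡ᵇ 3
  special₂ v = deg G J₂ v ≡ᵇ 3
  special₃ v = deg G J₃ v ≡ᵇ 3
  special v  = special₁ v ∨ special₂ v ∨ special₃ v

  open Discharge G special none all

  module _ {v : Fin (n G)} (ord : special v ≡ false) where

    deg₁ : deg G J₁ v ≡ 1
    deg₁ = join-deg G J₁ cubic join₁ v (∨-conicalˡ (special₁ v) _ ord)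

    deg₂ : deg G J₂ v ≡ 1
    deg₂ = join-deg G J₂ cubic join₂ v (∨-conicalˡ (special₂ v) _ (∨-conicalʳ (special₁ v) _ ord))

    deg₃ : deg G J₃ v ≡ 1
    deg₃ = join-deg G J₃ cubic join₃ v (∨-conicalʳ (special₂ v) _ (∨-conicalʳ (special₁ v) _ ord))

    -- For an edge in exactly t joins, its contribution on the left plus 2 equals its contribution
    -- on the right plus 2t; for t = 0, 1, 2, 3 both are 2, 2, 4, 6. Over the edges at `v` the terms
    -- 2 and 2t each add up to 6 and cancel.
    shared-all-none : deg G shared₁ v + deg G shared₂ v + deg G shared₃ v + deg G all v ≡ 2 * deg G none v
    shared-all-none = regroup
      (deg G shared₁ v) (deg G shared₂ v) (deg G shared₃ v) (deg G all v) (deg G none v) identity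
      where
      -- The summand 2 stands for two copies of `allEdges G`; it avoids subtraction.
      pointwise : ∀ a b c →
        ⟦ a ∧ (b ∨ c) ⟧ + (⟦ b ∧ (a ∨ c) ⟧ + (⟦ c ∧ (a ∨ b) ⟧ + (⟦ a ∧ b ∧ c ⟧ + 2)))
        ≡ ⟦ not (a ∨ b ∨ c) ⟧ + (⟦ not (a ∨ b ∨ c) ⟧ +
          (⟦ a ⟧ + (⟦ a ⟧ + (⟦ b ⟧ + (⟦ b ⟧ + (⟦ c ⟧ + (⟦ c ⟧ + 0)))))))
      pointwise true  true  true  = refl
      pointwise true  true  false = refl
      pointwise true  false true  = refl
      pointwise true  false false = refl
      pointwise false true  true  = refl
      pointwise false true  false = refl
      pointwise false false true  = refl
      pointwise false false false = refl
      identity : deg G shared₁ v + (deg G shared₂ v + (deg G shared₃ v + (deg G all v + 6)))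
                 ≡ deg G none v + (deg G none v + 6)
      identity with eq ← degs-cong G
        (shared₁ ∷ shared₂ ∷ shared₃ ∷ all ∷ allEdges G ∷ allEdges G ∷ [])
        (none ∷ none ∷ J₁ ∷ J₁ ∷ J₂ ∷ J₂ ∷ J₃ ∷ J₃ ∷ [])
        (λ e → pointwise (J₁ e) (J₂ e) (J₃ e)) v
        rewrite cubic v | deg₁ | deg₂ | deg₃ = eq
      regroup : ∀ a b c x z → a + (b + (c + (x + 6))) ≡ z + (z + 6) → a + b + c + x ≡ 2 * z
      regroup a b c x z eq = +-cancelʳ-≡ 6 _ _ (trans (left a b c x) (trans eq (right z)))
        where
        left : ∀ a b c x → a + b + c + x + 6 ≡ a + (b + (c + (x + 6)))
        left = solve-∀
        right : ∀ z → z + (z + 6) ≡ 2 * z + 6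
        right = solve-∀

    -- Summed over the edges at `v`, the three join indicators on the left and the constant 1 on the
    -- right both give 3 and cancel.
    none≤ : ∀ S S′ →
      (∀ e → ⟦ none e ⟧ + (⟦ J₁ e ⟧ + (⟦ J₂ e ⟧ + (⟦ J₃ e ⟧ + 0))) ≤ ⟦ S e ⟧ + (⟦ S′ e ⟧ + 1)) →
      deg G none v ≤ deg G S v + deg G S′ v
    none≤ S S′ le = +-cancelʳ-≤ 3 _ _ (≤-trans bound (≤-reflexive (sym (+-assoc (deg G S v) _ 3))))
      where
      bound : deg G none v + 3 ≤ deg G S v + (deg G S′ v + 3)
      bound with b ← degs-mono G (none ∷ J₁ ∷ J₂ ∷ J₃ ∷ []) (S ∷ S′ ∷ allEdges G ∷ []) le v
        rewrite cubic v | deg₁ | deg₂ | deg₃ = b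

  private
    -- The hypothesis of `none≤` at one edge. It holds for any two shared sets because an edge of
    -- exactly two joins lies in at least one of them and an edge of all three joins in both.
    LocalBound : (Bool → Bool → Bool → Bool) → (Bool → Bool → Bool → Bool) → Bool → Bool → Bool → Set
    LocalBound f g a b c =
      ⟦ not (a ∨ b ∨ c) ⟧ + (⟦ a ⟧ + (⟦ b ⟧ + (⟦ c ⟧ + 0))) ≤ ⟦ f a b c ⟧ + (⟦ g a b c ⟧ + 1)

    bound₁₂ : ∀ a b c → LocalBound (λ a b c → a ∧ (b ∨ c)) (λ a b c → b ∧ (a ∨ c)) a b c
    bound₁₂ true  true  true  = ≤-refl
    bound₁₂ true  true  false = n≤1+n 2
    bound₁₂ true  false true  = ≤-refl
    bound₁₂ true  false false = ≤-refl
    bound₁₂ false true  true  = ≤-refl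
    bound₁₂ false true  false = ≤-refl
    bound₁₂ false false true  = ≤-refl
    bound₁₂ false false false = ≤-refl

    bound₁₃ : ∀ a b c → LocalBound (λ a b c → a ∧ (b ∨ c)) (λ a b c → c ∧ (a ∨ b)) a b c
    bound₁₃ true  true  true  = ≤-refl
    bound₁₃ true  true  false = ≤-refl
    bound₁₃ true  false true  = n≤1+n 2
    bound₁₃ true  false false = ≤-refl
    bound₁₃ false true  true  = ≤-refl
    bound₁₃ false true  false = ≤-refl
    bound₁₃ false false true  = ≤-refl
    bound₁₃ false false false = ≤-refl

    bound₂₃ : ∀ a b c → LocalBound (λ a b c → b ∧ (a ∨ c)) (λ a b c → c ∧ (a ∨ b)) a b c
    bound₂₃ true  true  true  = ≤-refl
    bound₂₃ true  true  false = ≤-refl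
    bound₂₃ true  false true  = ≤-refl
    bound₂₃ true  false false = ≤-refl
    bound₂₃ false true  true  = n≤1+n 2
    bound₂₃ false true  false = ≤-refl
    bound₂₃ false false true  = ≤-refl
    bound₂₃ false false false = ≤-refl

  -- By `shared-all-none`, no `none`-edge means no E₃-edge. This supplies the E₀-edge needed by
  -- `quiet-exclusive`.
  all⇒none : ∀ {v} → special v ≡ false → 0 < deg G all v → 0 < deg G none v
  all⇒none {v} ord pos = n≢0⇒n>0 λ z → contradiction
    (m+n≡0⇒n≡0 (deg G shared₁ v + deg G shared₂ v + deg G shared₃ v) (trans (shared-all-none ord) (cong (2 *_) z)))
    (≢-sym (<⇒≢ pos))

  quiet₁₂ : ∀ {v} → 0 < deg G none v → Quiet shared₁ v → Quiet shared₂ v → ⊥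
  quiet₁₂ = quiet-exclusive (λ y ord → none≤ ord shared₁ shared₂ (λ e → bound₁₂ (J₁ e) (J₂ e) (J₃ e)))

  quiet₁₃ : ∀ {v} → 0 < deg G none v → Quiet shared₁ v → Quiet shared₃ v → ⊥
  quiet₁₃ = quiet-exclusive (λ y ord → none≤ ord shared₁ shared₃ (λ e → bound₁₃ (J₁ e) (J₂ e) (J₃ e)))

  quiet₂₃ : ∀ {v} → 0 < deg G none v → Quiet shared₂ v → Quiet shared₃ v → ⊥
  quiet₂₃ = quiet-exclusive (λ y ord → none≤ ord shared₂ shared₃ (λ e → bound₂₃ (J₁ e) (J₂ e) (J₃ e)))

  -- A granted bonus equals `deg G all v`; if this is positive, no two of the three bonuses are
  -- granted together.
  extra≤all : ∀ {v} → special v ≡ false → extra shared₁ v + extra shared₂ v + extra shared₃ v ≤ deg G all v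
  extra≤all {v} ord with all⇒none ord
  ... | none-pos with deg G all v
  -- Without an E₃-edge `v` may be quiet for several joins, but then each bonus is zero.
  ...   | zero = ≤-reflexive (cong₂ _+_ (cong₂ _+_ (if-0 (isYes (quiet? shared₁ v))) (if-0 (isYes (quiet? shared₂ v))))
                                        (if-0 (isYes (quiet? shared₃ v))))
    where
    if-0 : ∀ b → (if b then 0 else 0) ≡ 0
    if-0 true  = refl
    if-0 false = refl
  ...   | suc x with quiet? shared₁ v | quiet? shared₂ v | quiet? shared₃ v
  ...     | no _   | no _   | no _   = z≤n
  ...     | no _   | no _   | yes _  = ≤-refl
  ...     | no _   | yes _  | no _   = ≤-reflexive (+-identityʳ _)
  ...     | yes _  | no _   | no _   = ≤-reflexive (trans (+-identityʳ _) (+-identityʳ _))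
  ...     | yes q₁ | yes q₂ | _      = ⊥-elim (quiet₁₂ (none-pos (s≤s z≤n)) q₁ q₂)
  ...     | yes q₁ | no _   | yes q₃ = ⊥-elim (quiet₁₃ (none-pos (s≤s z≤n)) q₁ q₃)
  ...     | no _   | yes q₂ | yes q₃ = ⊥-elim (quiet₂₃ (none-pos (s≤s z≤n)) q₂ q₃)

  specials : Fin (n G) → ℕ
  specials v = ⟦ special₁ v ⟧ + ⟦ special₂ v ⟧ + ⟦ special₃ v ⟧

  -- A special vertex pays 2 for each of three joins, hence the 6. Elsewhere, bounding the bonuses
  -- by `deg G all v` produces the left side of `shared-all-none`.
  weight≤ : ∀ v → weight shared₁ v + weight shared₂ v + weight shared₃ v ≤ 2 * deg G none v + 6 * specials v
  weight≤ v with special v in s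
  ... | true  = ≤-trans (*-monoʳ-≤ 6 (some (special₁ v) (special₂ v) (special₃ v) s)) (m≤n+m _ (2 * deg G none v))
    where
    some : ∀ a b c → a ∨ b ∨ c ≡ true → 1 ≤ ⟦ a ⟧ + ⟦ b ⟧ + ⟦ c ⟧
    some true  _     _    _ = s≤s z≤n
    some false true  _    _ = s≤s z≤n
    some false false true _ = s≤s z≤n
  ... | false = begin
    (b₁ + x₁) + (b₂ + x₂) + (b₃ + x₃)    ≡⟨ regroup b₁ x₁ b₂ x₂ b₃ x₃ ⟩
    (b₁ + b₂ + b₃) + (x₁ + x₂ + x₃)      ≤⟨ +-monoʳ-≤ (b₁ + b₂ + b₃) (extra≤all s) ⟩
    (b₁ + b₂ + b₃) + deg G all v         ≡⟨ shared-all-none s ⟩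
    2 * deg G none v                     ≤⟨ m≤m+n _ _ ⟩
    2 * deg G none v + 6 * specials v    ∎
    where
    open ≤-Reasoning
    b₁ b₂ b₃ x₁ x₂ x₃ : ℕ
    b₁ = deg G shared₁ v
    b₂ = deg G shared₂ v
    b₃ = deg G shared₃ v
    x₁ = extra shared₁ v
    x₂ = extra shared₂ v
    x₃ = extra shared₃ v
    regroup : ∀ b₁ x₁ b₂ x₂ b₃ x₃ → (b₁ + x₁) + (b₂ + x₂) + (b₃ + x₃) ≡ (b₁ + b₂ + b₃) + (x₁ + x₂ + x₃)
    regroup = solve-∀

  odd₁ : 2 * oddComponents G (complement G J₁) ≤ sum (weight shared₁)
  odd₁ = Components.oddComponents≤ G (complement G J₁) 2 (weight shared₁) λ u odd →
    odd-weight J₁ J₂ J₃ (λ _ → refl) avoid (λ _ → deg₂) (λ _ → deg₃)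
      (reachSet G (complement G J₁) u) (Components.reach-closed G (complement G J₁) u) odd
    where
    avoid : ∀ e → none e ≡ true → not (J₁ e) ≡ true
    avoid e p with J₁ e
    ... | false = refl

  odd₂ : 2 * oddComponents G (complement G J₂) ≤ sum (weight shared₂)
  odd₂ = Components.oddComponents≤ G (complement G J₂) 2 (weight shared₂) λ u odd →
    odd-weight J₂ J₁ J₃ swap avoid (λ _ → deg₁) (λ _ → deg₃)
      (reachSet G (complement G J₂) u) (Components.reach-closed G (complement G J₂) u) odd
    where
    swap : ∀ e → all e ≡ J₂ e ∧ J₁ e ∧ J₃ e
    swap e with J₁ e | J₂ e
    ... | true  | true  = refl
    ... | true  | false = refl
    ... | false | true  = refl
    ... | false | false = refl
    avoid : ∀ e → none e ≡ true → not (J₂ e) ≡ true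
    avoid e p with J₁ e | J₂ e
    ... | false | false = refl

  odd₃ : 2 * oddComponents G (complement G J₃) ≤ sum (weight shared₃)
  odd₃ = Components.oddComponents≤ G (complement G J₃) 2 (weight shared₃) λ u odd →
    odd-weight J₃ J₁ J₂ (λ e → trans (sym (∧-assoc (J₁ e) (J₂ e) (J₃ e))) (∧-comm (J₁ e ∧ J₂ e) (J₃ e)))
      avoid (λ _ → deg₁) (λ _ → deg₂)
      (reachSet G (complement G J₃) u) (Components.reach-closed G (complement G J₃) u) odd
    where
    avoid : ∀ e → none e ≡ true → not (J₃ e) ≡ true
    avoid e p with J₁ e | J₂ e | J₃ e
    ... | false | false | false = refl

  sum-specials : sum specials ≡ nJ G J₁ + nJ G J₂ + nJ G J₃
  sum-specials = begin
    sum specials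
      ≡⟨ ∑-distrib-+ (λ v → ⟦ special₁ v ⟧ + ⟦ special₂ v ⟧) (λ v → ⟦ special₃ v ⟧) ⟩
    sum (λ v → ⟦ special₁ v ⟧ + ⟦ special₂ v ⟧) + sum (λ v → ⟦ special₃ v ⟧)
      ≡⟨ cong (_+ sum (λ v → ⟦ special₃ v ⟧)) (∑-distrib-+ (λ v → ⟦ special₁ v ⟧) (λ v → ⟦ special₂ v ⟧)) ⟩
    sum (λ v → ⟦ special₁ v ⟧) + sum (λ v → ⟦ special₂ v ⟧) + sum (λ v → ⟦ special₃ v ⟧)
      ≡⟨ cong₂ _+_ (cong₂ _+_ (count≡sum special₁) (count≡sum special₂)) (count≡sum special₃) ⟨
    nJ G J₁ + nJ G J₂ + nJ G J₃  ∎
    where open ≡-Reasoning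

  doubled : 2 * (oddComponents G (complement G J₁) + oddComponents G (complement G J₂) + oddComponents G (complement G J₃))
            ≤ 2 * (2 * E0 G J₁ J₂ J₃ + 3 * (nJ G J₁ + nJ G J₂ + nJ G J₃))
  doubled = begin
    2 * (o₁ + o₂ + o₃)
      ≡⟨ distrib o₁ o₂ o₃ ⟩
    2 * o₁ + 2 * o₂ + 2 * o₃
      ≤⟨ +-mono-≤ (+-mono-≤ odd₁ odd₂) odd₃ ⟩
    sum w₁ + sum w₂ + sum w₃
      ≡⟨ cong (_+ sum w₃) (∑-distrib-+ w₁ w₂) ⟨
    sum (λ v → w₁ v + w₂ v) + sum w₃
      ≡⟨ ∑-distrib-+ (λ v → w₁ v + w₂ v) w₃ ⟨
    sum (λ v → w₁ v + w₂ v + w₃ v)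
      ≤⟨ sum-mono weight≤ ⟩
    sum (λ v → 2 * deg G none v + 6 * specials v)
      ≡⟨ ∑-distrib-+ (λ v → 2 * deg G none v) (λ v → 6 * specials v) ⟩
    sum (λ v → 2 * deg G none v) + sum (λ v → 6 * specials v)
      ≡⟨ cong₂ _+_ (*-distribˡ-sum 2 (deg G none)) (*-distribˡ-sum 6 specials) ⟨
    2 * sum (deg G none) + 6 * sum specials
      -- Each E₀-edge is seen from both of its ends, whence the second factor 2.
      ≡⟨ cong₂ (λ a b → 2 * a + 6 * b) (sum-deg G none) sum-specials ⟩
    2 * (2 * E0 G J₁ J₂ J₃) + 6 * N
      ≡⟨ factor (E0 G J₁ J₂ J₃) N ⟩
    2 * (2 * E0 G J₁ J₂ J₃ + 3 * N)  ∎
    where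
    open ≤-Reasoning
    o₁ o₂ o₃ N : ℕ
    o₁ = oddComponents G (complement G J₁)
    o₂ = oddComponents G (complement G J₂)
    o₃ = oddComponents G (complement G J₃)
    N  = nJ G J₁ + nJ G J₂ + nJ G J₃
    w₁ w₂ w₃ : Fin (n G) → ℕ
    w₁ = weight shared₁
    w₂ = weight shared₂
    w₃ = weight shared₃
    distrib : ∀ a b c → 2 * (a + b + c) ≡ 2 * a + 2 * b + 2 * c
    distrib = solve-∀
    factor : ∀ a b → 2 * (2 * a) + 6 * b ≡ 2 * (2 * a + 3 * b)
    factor = solve-∀

-- The right-hand side is 2k with the fraction cleared, so the inequality stays in `ℕ`.
theorem2p3 : (G : Graph) → Cubic G → Bridgeless G →
    (J₁ J₂ J₃ : EdgeSet G) → IsJoin G J₁ → IsJoin G J₂ → IsJoin G J₃ →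
    oddComponents G (complement G J₁) + oddComponents G (complement G J₂) + oddComponents G (complement G J₃)
      ≤ 2 * E0 G J₁ J₂ J₃ + 3 * (nJ G J₁ + nJ G J₂ + nJ G J₃)
theorem2p3 G cubic _ J₁ J₂ J₃ join₁ join₂ join₃ =
  *-cancelˡ-≤ 2 (Joins.doubled G cubic J₁ J₂ J₃ join₁ join₂ join₃)
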